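{- Let $G$ be a finite directed acyclic graph with a unique source $s$ and a unique sink $t$ and with no idle edges. Then $G$ satisfies degree equality if and only if $G$ admits a route decomposition.
   Context: Directed graphs may have parallel edges. The vertices of $G$ are linearly ordered $s<1<2<\cdots<n<t$ so that every directed edge $(i,j)$ has $i<j$; the vertices $1,\dots,n$ are called inner vertices. An edge is idle if it is the only incoming edge or the only outgoing edge of some inner vertex. A route is a directed path in $G$ from $s$ to $t$ (regarded as a sequence of edges). $G$ satisfies degree equality if $\mathrm{indeg}_G(v)=\mathrm{outdeg}_G(v)$ for every inner vertex $v$. A route decomposition of $G$ is a set $\mathcal{R}$ of routes in $G$ such that the edge set of $G$ is the disjoint union of the edge sets of the routes in $\mathcal{R}$. -}

module Defs where

open import Data.Fin.Base using (Fin; zero; fromℕ; _<_)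
open import Data.Fin.Properties using (_≟_)
open import Data.List.Base using (List; []; _∷_; allFin; filter; length)
open import Data.List.Membership.Propositional using (_∈_)
open import Data.Nat.Base using (ℕ; suc)
open import Data.Product.Base using (_×_; ∃; ∃-syntax)
open import Data.Sum.Base using (_⊎_)
open import Level using (Level; 0ℓ)
open import Relation.Binary.PropositionalEquality.Core using (_≡_; _≢_)
open import Relation.Nullary.Negation.Core using (¬_)
open import Relation.Unary using (Pred)

-- A finite directed graph, parallel edges allowed, whose vertices are listed
-- as s < 1 < ⋯ < n < t compatibly with its edges; in particular it is acyclic.
-- Edges are labelled, so that parallel edges are distinct elements of Edge.
record DAG : Set where
  field
    n m     : ℕ

  Vertex : Set
  Vertex = Fin (suc (suc n))

  Edge : Set
  Edge = Fin m

  field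
    src tgt : Edge → Vertex
    src<tgt : ∀ e → src e < tgt e

  s t : Vertex
  s = zero
  t = fromℕ (suc n)

module _ (G : DAG) where
  open DAG G

  Inner : Vertex → Set
  Inner v = v ≢ s × v ≢ t

  indeg outdeg : Vertex → ℕ
  indeg  v = length (filter (λ e → tgt e ≟ v) (allFin m))
  outdeg v = length (filter (λ e → src e ≟ v) (allFin m))

  IsSource IsSink : Vertex → Set
  IsSource v = indeg  v ≡ 0
  IsSink   v = outdeg v ≡ 0

  UniqueSource UniqueSink : Set
  UniqueSource = IsSource s × (∀ v → IsSource v → v ≡ s)
  UniqueSink   = IsSink   t × (∀ v → IsSink   v → v ≡ t)

  OnlyIncoming OnlyOutgoing : Edge → Vertex → Set
  OnlyIncoming e v = tgt e ≡ v × (∀ e′ → tgt e′ ≡ v → e′ ≡ e)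
  OnlyOutgoing e v = src e ≡ v × (∀ e′ → src e′ ≡ v → e′ ≡ e)

  Idle : Edge → Set
  Idle e = ∃[ v ] Inner v × (OnlyIncoming e v ⊎ OnlyOutgoing e v)

  NoIdleEdges : Set
  NoIdleEdges = ∀ e → ¬ Idle e

  DegreeEquality : Set
  DegreeEquality = ∀ v → Inner v → indeg v ≡ outdeg v

  data IsPath : Vertex → Vertex → List Edge → Set where
    []  : ∀ {v} → IsPath v v []
    _∷_ : ∀ {u v e es} → src e ≡ u → IsPath (tgt e) v es → IsPath u v (e ∷ es)

  -- A route is identified with its sequence of edges.
  IsRoute : Pred (List Edge) 0ℓ
  IsRoute = IsPath s t

  record IsRouteDecomposition {ℓ : Level} (R : Pred (List Edge) ℓ) : Set ℓ where
    field
      routes   : ∀ p → R p → IsRoute p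
      covering : ∀ e → ∃[ p ] R p × e ∈ p
      disjoint : ∀ p q → R p → R q → ∀ e → e ∈ p → e ∈ q → p ≡ q

  HasRouteDecomposition : Set₁
  HasRouteDecomposition = ∃ λ (R : Pred (List Edge) 0ℓ) → IsRouteDecomposition R

{-# OPTIONS --safe #-}
-- Under degree equality, match the incoming and outgoing
-- edges of every inner vertex by their position in the edge list; the maximal
-- chains of matched edges starting at s are the routes. They cover every edge
-- since chains extend forwards until t and backwards until s, and they are
-- disjoint since the matching determines a chain from its first edge and the
-- first edge from any edge of the chain. Conversely, in a route decomposition
-- the route through an edge entering an inner vertex v leaves v by an edge that
-- determines the route, and hence the entering edge because a route enters v
-- at most once; so indeg v ≤ outdeg v, and symmetrically outdeg v ≤ indeg v.
module Submission where

open import Defs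
open import Data.Fin.Base using (Fin; zero; suc; toℕ; _≤_; _<_; _>_)
open import Data.Fin.Induction using (<-wellFounded; >-wellFounded)
open import Data.Fin.Properties using (_≟_; ≤fromℕ; injective⇒≤)
open import Data.List.Base using (List; []; _∷_; allFin; filter; length; lookup)
open import Data.List.Membership.Propositional using (_∈_)
open import Data.List.Membership.Propositional.Properties
  using (∈-lookup; ∈-allFin; ∈-filter⁺; ∈-filter⁻)
open import Data.List.Membership.Setoid.Properties using (index-injective)
open import Data.List.Relation.Unary.All as All using ()
open import Data.List.Relation.Unary.AllPairs using (_∷_)
open import Data.List.Relation.Unary.Any using (here; there; index)
open import Data.List.Relation.Unary.Unique.Propositional using (Unique)
open import Data.List.Relation.Unary.Unique.Propositional.Properties
  using (allFin⁺; filter⁺)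
import Data.Nat.Base as ℕ
import Data.Nat.Properties as ℕ
open import Data.Product.Base using (_×_; _,_; ∃-syntax; proj₁; proj₂)
open import Function.Base using (_∘_; flip)
open import Function.Bundles using (_⇔_; mk⇔)
open import Induction.WellFounded using (Acc; acc)
open import Relation.Binary.Construct.Closure.ReflexiveTransitive
  using (Star; ε; _◅_; _◅◅_)
open import Relation.Binary.PropositionalEquality
  using (_≡_; _≢_; refl; sym; trans; cong; subst; setoid)
open import Relation.Nullary using (yes; no; contradiction)

-- Counting and positional matching in lists.

module _ {A : Set} where

  lookup-injective : ∀ {xs : List A} → Unique xs →
    ∀ i j → lookup xs i ≡ lookup xs j → i ≡ j
  lookup-injective {_ ∷ _} _         zero    zero    _  = refl
  lookup-injective {_ ∷ _} (x≢ ∷ _)  zero    (suc j) eq =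
    contradiction eq (All.lookup x≢ (∈-lookup j))
  lookup-injective {_ ∷ _} (x≢ ∷ _)  (suc i) zero    eq =
    contradiction (sym eq) (All.lookup x≢ (∈-lookup i))
  lookup-injective {_ ∷ _} (_ ∷ xs!) (suc i) (suc j) eq =
    cong suc (lookup-injective xs! i j eq)

  -- `total` chooses a partner for each position of `xs`. Partners at the same position of `ys` are
  -- equal, so by `inj` the entries of `xs` are equal, and so are their positions because `xs` has
  -- no repetitions.
  injectiveRelation⇒length≤ : ∀ {xs ys : List A} (R : A → A → Set) → Unique xs →
    (∀ {x} → x ∈ xs → ∃[ y ] y ∈ ys × R x y) →
    (∀ {x x′ y} → R x y → R x′ y → x ≡ x′) →
    length xs ℕ.≤ length ys
  injectiveRelation⇒length≤ {xs} {ys} R xs! total inj =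
    injective⇒≤ {f = position} λ {i} {j} eq →
      lookup-injective xs! i j
        (inj (related i) (subst (R _) (sym (sameImage i j eq)) (related j)))
    where
    image : ∀ i → ∃[ y ] y ∈ ys × R (lookup xs i) y
    image i = total (∈-lookup i)

    related : ∀ i → R (lookup xs i) (proj₁ (image i))
    related i = proj₂ (proj₂ (image i))

    position : Fin (length xs) → Fin (length ys)
    position i = index (proj₁ (proj₂ (image i)))

    sameImage : ∀ i j → position i ≡ position j → proj₁ (image i) ≡ proj₁ (image j)
    sameImage i j = index-injective (setoid A)
      (proj₁ (proj₂ (image i))) (proj₁ (proj₂ (image j)))

  -- The two entries stand at the same position. As a relation on values it can be read in both
  -- directions, and it makes sense for lists of different lengths.
  data Matched (x y : A) : List A → List A → Set where
    here  : ∀ {xs ys} → Matched x y (x ∷ xs) (y ∷ ys)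
    there : ∀ {x′ y′ xs ys} → Matched x y xs ys → Matched x y (x′ ∷ xs) (y′ ∷ ys)

  matched-sym : ∀ {x y xs ys} → Matched x y xs ys → Matched y x ys xs
  matched-sym here      = here
  matched-sym (there m) = there (matched-sym m)

  matched⇒∈ : ∀ {x y xs ys} → Matched x y xs ys → x ∈ xs
  matched⇒∈ here      = here refl
  matched⇒∈ (there m) = there (matched⇒∈ m)

  matched-total : ∀ {x xs ys} → length xs ≡ length ys → x ∈ xs →
    ∃[ y ] Matched x y xs ys
  matched-total {ys = y ∷ _} _  (here refl) = y , here
  matched-total {ys = _ ∷ _} eq (there x∈)  =
    let y , m = matched-total (ℕ.suc-injective eq) x∈ in y , there m

  matched-functional : ∀ {x y y′ xs ys} → Unique xs →
    Matched x y xs ys → Matched x y′ xs ys → y ≡ y′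
  matched-functional _         here      here       = refl
  matched-functional (x≢ ∷ _)  here      (there m)  =
    contradiction refl (All.lookup x≢ (matched⇒∈ m))
  matched-functional (x≢ ∷ _)  (there m) here       =
    contradiction refl (All.lookup x≢ (matched⇒∈ m))
  matched-functional (_ ∷ xs!) (there m) (there m′) = matched-functional xs! m m′

-- Matched edges and the trails they form.

module _ (G : DAG) where
  open DAG G

  incoming outgoing : Vertex → List Edge
  incoming v = filter (λ e → tgt e ≟ v) (allFin m)
  outgoing v = filter (λ e → src e ≟ v) (allFin m)

  incoming! : ∀ v → Unique (incoming v)
  incoming! v = filter⁺ (λ e → tgt e ≟ v) (allFin⁺ m)

  outgoing! : ∀ v → Unique (outgoing v)
  outgoing! v = filter⁺ (λ e → src e ≟ v) (allFin⁺ m)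

  ∈-incoming⁺ : ∀ {e v} → tgt e ≡ v → e ∈ incoming v
  ∈-incoming⁺ {e} {v} = ∈-filter⁺ (λ e → tgt e ≟ v) (∈-allFin e)

  ∈-outgoing⁺ : ∀ {e v} → src e ≡ v → e ∈ outgoing v
  ∈-outgoing⁺ {e} {v} = ∈-filter⁺ (λ e → src e ≟ v) (∈-allFin e)

  ∈-incoming⁻ : ∀ {e v} → e ∈ incoming v → tgt e ≡ v
  ∈-incoming⁻ {v = v} = proj₂ ∘ ∈-filter⁻ (λ e → tgt e ≟ v) {xs = allFin m}

  ∈-outgoing⁻ : ∀ {e v} → e ∈ outgoing v → src e ≡ v
  ∈-outgoing⁻ {v = v} = proj₂ ∘ ∈-filter⁻ (λ e → src e ≟ v) {xs = allFin m}

  src≢t : ∀ e → src e ≢ t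
  src≢t e eq = ℕ.<⇒≱ (src<tgt e) (subst (tgt e ≤_) (sym eq) (≤fromℕ (tgt e)))

  tgt≢s : ∀ e → tgt e ≢ s
  tgt≢s e eq = ℕ.n≮0 (subst (src e <_) eq (src<tgt e))

  tgt-inner : ∀ {e} → tgt e ≢ t → Inner G (tgt e)
  tgt-inner {e} ≢t = tgt≢s e , ≢t

  src-inner : ∀ {e} → src e ≢ s → Inner G (src e)
  src-inner {e} ≢s = ≢s , src≢t e

  -- The vertex is existential, which treats both edges alike; membership in the two lists forces it
  -- to be `tgt e` and `src f`.
  Next : Edge → Edge → Set
  Next e f = ∃[ v ] Matched e f (incoming v) (outgoing v)

  next⇒adjacent : ∀ {e f} → Next e f → tgt e ≡ src f
  next⇒adjacent (_ , m) =
    trans (∈-incoming⁻ (matched⇒∈ m)) (sym (∈-outgoing⁻ (matched⇒∈ (matched-sym m))))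

  next-functional : ∀ {e f f′} → Next e f → Next e f′ → f ≡ f′
  next-functional (v , m) (v′ , m′)
    with refl ← trans (sym (∈-incoming⁻ (matched⇒∈ m))) (∈-incoming⁻ (matched⇒∈ m′)) =
    matched-functional (incoming! v) m m′

  next-injective : ∀ {e e′ f} → Next e f → Next e′ f → e ≡ e′
  next-injective (v , m) (v′ , m′)
    with refl ← trans (sym (∈-outgoing⁻ (matched⇒∈ (matched-sym m))))
                      (∈-outgoing⁻ (matched⇒∈ (matched-sym m′))) =
    matched-functional (outgoing! v) (matched-sym m) (matched-sym m′)

  -- A chain of matched edges, indexed by its first edge. It may stop only at `t`, but it may start
  -- anywhere, so it can be prolonged backwards.
  data Trail : Edge → List Edge → Set where
    last : ∀ {e} → tgt e ≡ t → Trail e (e ∷ [])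
    _∷_  : ∀ {e f p} → Next e f → Trail f p → Trail e (e ∷ p)

  trail⇒path : ∀ {e p} → Trail e p → IsPath G (src e) t p
  trail⇒path (last eq)  = refl ∷ subst (λ v → IsPath G v t []) (sym eq) []
  trail⇒path (nx ∷ tr) =
    refl ∷ subst (λ v → IsPath G v t _) (sym (next⇒adjacent nx)) (trail⇒path tr)

  next⇒tgt≢t : ∀ {e f} → Next e f → tgt e ≢ t
  next⇒tgt≢t {f = f} nx eq = src≢t f (trans (sym (next⇒adjacent nx)) eq)

  next⇒src≢s : ∀ {e f} → Next e f → src f ≢ s
  next⇒src≢s {e} nx eq = tgt≢s e (trans (next⇒adjacent nx) eq)

  -- No edge leaves `t`, so a trail must stop there; before that, the matching dictates each further
  -- edge.
  trail-functional : ∀ {e p q} → Trail e p → Trail e q → p ≡ q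
  trail-functional (last _)  (last _)    = refl
  trail-functional (last eq) (nx ∷ _)    = contradiction eq (next⇒tgt≢t nx)
  trail-functional (nx ∷ _)  (last eq)   = contradiction eq (next⇒tgt≢t nx)
  trail-functional (nx ∷ tr) (nx′ ∷ tr′)
    with refl ← next-functional nx nx′ = cong (_ ∷_) (trail-functional tr tr′)

  ∈-trail⇒backwards : ∀ {e f p} → Trail e p → f ∈ p → Star (flip Next) f e
  ∈-trail⇒backwards (last _)  (here refl) = ε
  ∈-trail⇒backwards (_ ∷ _)   (here refl) = ε
  ∈-trail⇒backwards (nx ∷ tr) (there f∈)  = ∈-trail⇒backwards tr f∈ ◅◅ (nx ◅ ε)

  -- Backward steps are deterministic, and no edge is matched before one that leaves `s`, so both
  -- chains stop at the same place.
  origin-unique : ∀ {e a b} → Star (flip Next) e a → Star (flip Next) e b →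
    src a ≡ s → src b ≡ s → a ≡ b
  origin-unique ε         ε           _  _  = refl
  origin-unique ε         (nx ◅ _)    a≡ _  = contradiction a≡ (next⇒src≢s nx)
  origin-unique (nx ◅ _)  ε           _  b≡ = contradiction b≡ (next⇒src≢s nx)
  origin-unique (nx ◅ st) (nx′ ◅ st′) a≡ b≡
    with refl ← next-injective nx nx′ = origin-unique st st′ a≡ b≡

  -- From degree equality to a route decomposition.

  module _ (deg≡ : DegreeEquality G) where

    next : ∀ {e} → tgt e ≢ t → ∃[ f ] Next e f
    next {e} ≢t =
      let f , m = matched-total (deg≡ (tgt e) (tgt-inner ≢t)) (∈-incoming⁺ refl)
      in f , tgt e , m

    previous : ∀ {e} → src e ≢ s → ∃[ f ] Next f e
    previous {e} ≢s =
      let f , m = matched-total (sym (deg≡ (src e) (src-inner ≢s))) (∈-outgoing⁺ refl)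
      in f , src e , matched-sym m

    trailFrom : ∀ e → Acc _>_ (src e) → ∃[ p ] Trail e p
    trailFrom e (acc rs) with tgt e ≟ t
    ... | yes eq = e ∷ [] , last eq
    ... | no  ≢t =
      let f , nx = next ≢t
          -- The recursion ends because `f` starts where `e` ends, strictly beyond `src e`.
          p , tr = trailFrom f (rs (subst (src e <_) (next⇒adjacent nx) (src<tgt e)))
      in e ∷ p , nx ∷ tr

    -- The trail grows at its front while `f` stays on it; the source of the first edge decreases
    -- until it is `s`.
    extendToSource : ∀ {f e p} → Acc _<_ (src e) → Trail e p → f ∈ p →
      ∃[ q ] (∃[ a ] src a ≡ s × Trail a q) × f ∈ q
    extendToSource {e = e} {p} (acc rs) tr f∈p with src e ≟ s
    ... | yes eq = p , (e , eq , tr) , f∈p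
    ... | no  ≢s =
      let d , nx = previous ≢s
      in extendToSource (rs (subst (src d <_) (next⇒adjacent nx) (src<tgt d)))
           (nx ∷ tr) (there f∈p)

    head∈trail : ∀ {e p} → Trail e p → e ∈ p
    head∈trail (last _) = here refl
    head∈trail (_ ∷ _)  = here refl

    degreeEquality⇒decomposition : HasRouteDecomposition G
    degreeEquality⇒decomposition = (λ p → ∃[ a ] src a ≡ s × Trail a p) , record
      { routes   = λ p (_ , eq , tr) → subst (λ v → IsPath G v t p) eq (trail⇒path tr)
      ; covering = λ e → let _ , tr = trailFrom e (>-wellFounded _)
                         in extendToSource (<-wellFounded _) tr (head∈trail tr)
      ; disjoint = disjoint
      }
      where
      disjoint : ∀ p q → (∃[ a ] src a ≡ s × Trail a p) → (∃[ b ] src b ≡ s × Trail b q) →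
        ∀ e → e ∈ p → e ∈ q → p ≡ q
      disjoint _ _ (_ , a≡ , tr) (_ , b≡ , tr′) _ e∈p e∈q
        with refl ← origin-unique (∈-trail⇒backwards tr e∈p) (∈-trail⇒backwards tr′ e∈q) a≡ b≡ =
        trail-functional tr tr′

  -- Edges of a path at a given vertex.

  path-start≤src : ∀ {u v p f} → IsPath G u v p → f ∈ p → u ≤ src f
  path-start≤src (refl ∷ _)    (here refl) = ℕ.≤-refl
  path-start≤src (refl ∷ path) (there f∈)  =
    ℕ.≤-trans (ℕ.<⇒≤ (src<tgt _)) (path-start≤src path f∈)

  -- Of two edges on a path, the earlier ends no later than the other starts, so `g` strictly
  -- increases along the path. A general `g` serves `src` and `tgt` at once.
  path-injective : (g : Edge → Vertex) → (∀ {e f} → tgt e ≤ src f → g e < g f) →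
    ∀ {u v p e f} → IsPath G u v p → e ∈ p → f ∈ p → g e ≡ g f → e ≡ f
  path-injective g mono (_ ∷ _)    (here refl) (here refl) _  = refl
  path-injective g mono (_ ∷ path) (here refl) (there f∈)  eq =
    contradiction (cong toℕ eq) (ℕ.<⇒≢ (mono (path-start≤src path f∈)))
  path-injective g mono (_ ∷ path) (there e∈)  (here refl) eq =
    contradiction (cong toℕ (sym eq)) (ℕ.<⇒≢ (mono (path-start≤src path e∈)))
  path-injective g mono (_ ∷ path) (there e∈)  (there f∈)  eq =
    path-injective g mono path e∈ f∈ eq

  path-src-injective : ∀ {u v p e f} → IsPath G u v p → e ∈ p → f ∈ p →
    src e ≡ src f → e ≡ f
  path-src-injective = path-injective src λ {e} → ℕ.<-≤-trans (src<tgt e)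

  path-tgt-injective : ∀ {u v p e f} → IsPath G u v p → e ∈ p → f ∈ p →
    tgt e ≡ tgt f → e ≡ f
  path-tgt-injective = path-injective tgt λ {_} {f} ≤src → ℕ.≤-<-trans ≤src (src<tgt f)

  path-successor : ∀ {u v p e} → IsPath G u v p → e ∈ p → tgt e ≢ v →
    ∃[ f ] f ∈ p × src f ≡ tgt e
  path-successor (_ ∷ [])        (here refl) ≢v = contradiction refl ≢v
  path-successor (_ ∷ (eq ∷ _))  (here refl) _  = _ , there (here refl) , eq
  path-successor (_ ∷ path)      (there e∈)  ≢v =
    let f , f∈ , eq = path-successor path e∈ ≢v in f , there f∈ , eq

  path-predecessor : ∀ {u v p e} → IsPath G u v p → e ∈ p → src e ≢ u →
    ∃[ f ] f ∈ p × tgt f ≡ src e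
  path-predecessor (eq ∷ _) (here refl) ≢u = contradiction eq ≢u
  -- If `e` starts where `d` ends, then `d` is the answer; otherwise `e` does not start at the first
  -- vertex of the remaining path, which is what the recursive call requires.
  path-predecessor {e = e} (_∷_ {e = d} _ path) (there e∈) _ with src e ≟ tgt d
  ... | yes eq = d , here refl , sym eq
  ... | no  ≢d = let f , f∈ , eq = path-predecessor path e∈ ≢d in f , there f∈ , eq

  -- From a route decomposition to degree equality.

  decomposition⇒degreeEquality : HasRouteDecomposition G → DegreeEquality G
  decomposition⇒degreeEquality (R , dec) v (v≢s , v≢t) = ℕ.≤-antisym
    -- Sharing a route with `f` does not single out `e`; entering `v` as well does, so `tgt e ≡ v`
    -- is built into the relation.
    (injectiveRelation⇒length≤ (λ e f → tgt e ≡ v × OnCommonRoute e f) (incoming! v)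
      (λ {e} e∈ →
        let e→v          = ∈-incoming⁻ e∈
            p , Rp , e∈p = covering e
            f , f∈p , eq = path-successor (routes p Rp) e∈p (v≢t ∘ trans (sym e→v))
        in f , ∈-outgoing⁺ (trans eq e→v) , e→v , p , Rp , e∈p , f∈p)
      (λ (e→v , c) (e′→v , c′) →
        injective path-tgt-injective c c′ (trans e→v (sym e′→v))))
    (injectiveRelation⇒length≤ (λ e f → src e ≡ v × OnCommonRoute e f) (outgoing! v)
      (λ {e} e∈ →
        let v→e          = ∈-outgoing⁻ e∈
            p , Rp , e∈p = covering e
            f , f∈p , eq = path-predecessor (routes p Rp) e∈p (v≢s ∘ trans (sym v→e))
        in f , ∈-incoming⁺ (trans eq v→e) , v→e , p , Rp , e∈p , f∈p)
      (λ (v→e , c) (v→e′ , c′) →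
        injective path-src-injective c c′ (trans v→e (sym v→e′))))
    where
    open IsRouteDecomposition dec

    OnCommonRoute : Edge → Edge → Set
    OnCommonRoute e f = ∃[ p ] R p × e ∈ p × f ∈ p

    -- Both routes contain `f`, so disjointness makes them one, and `inj` compares `e` and `e′` on
    -- it.
    injective : ∀ {g : Edge → Vertex} →
      (∀ {u v p e e′} → IsPath G u v p → e ∈ p → e′ ∈ p → g e ≡ g e′ → e ≡ e′) →
      ∀ {e e′ f} → OnCommonRoute e f → OnCommonRoute e′ f → g e ≡ g e′ → e ≡ e′
    injective inj (p , Rp , e∈p , f∈p) (q , Rq , e′∈q , f∈q) eq
      with refl ← disjoint p q Rp Rq _ f∈p f∈q = inj (routes p Rp) e∈p e′∈q eq

theorem3p5 : (G : DAG) → UniqueSource G → UniqueSink G → NoIdleEdges G →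
    DegreeEquality G ⇔ HasRouteDecomposition G
theorem3p5 G _ _ _ = mk⇔ (degreeEquality⇒decomposition G) (decomposition⇒degreeEquality G)
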